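{- Let $t\le k$ and $n$ be positive integers. If there exists an orthogonal array OA$(t,k,n)$, then there exists a large set of orthogonal arrays LOA$(t,k,n)$.
   Context: An orthogonal array OA$(t,k,n)$ is an $n^t\times k$ matrix with entries from $\mathbb{Z}_n$ such that in the submatrix formed by any $t$ columns each ordered $t$-tuple over $\mathbb{Z}_n$ occurs exactly once as a row. A large set of orthogonal arrays LOA$(t,k,n)$ is a set of $n^{k-t}$ orthogonal arrays OA$(t,k,n)$ such that each vector of length $k$ over $\mathbb{Z}_n$ occurs as a row in exactly one of them. -}

module Defs where

open import Data.Fin.Base using (Fin)
open import Data.Nat.Base using (ℕ; _∸_; _^_)
open import Data.Product using (∃; ∃!)
open import Data.Vec.Functional using (Vector)
open import Function.Base using (_∘_)
open import Function.Definitions using (Injective)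
open import Relation.Binary.PropositionalEquality using (_≡_; _≗_)

-- Functions are compared pointwise throughout, as there is no function
-- extensionality.

Matrix : Set → ℕ → ℕ → Set
Matrix A m k = Vector (Vector A k) m

_≋_ : ∀ {A m k} → Matrix A m k → Matrix A m k → Set
M ≋ N = ∀ r → M r ≗ N r

-- ℤ_n is represented by Fin n; a choice of t columns is an injection
-- c : Fin t → Fin k, and M r ∘ c is row r of the corresponding submatrix.

IsOrthogonalArray : (t k n : ℕ) → Matrix (Fin n) (n ^ t) k → Set
IsOrthogonalArray t k n M =
  (c : Fin t → Fin k) → Injective _≡_ _≡_ c →
  (x : Vector (Fin n) t) → ∃! _≡_ λ r → M r ∘ c ≗ x

_OccursIn_ : ∀ {A m k} → Vector A k → Matrix A m k → Set
v OccursIn M = ∃ λ r → M r ≗ v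

-- A set of n ^ (k ∸ t) arrays is given by an enumeration without repetition.
-- The truncated subtraction is the true one only when t ≤ k.

record IsLargeSet (t k n : ℕ)
                  (L : Fin (n ^ (k ∸ t)) → Matrix (Fin n) (n ^ t) k) : Set where
  field
    distinct   : Injective _≡_ _≋_ L
    orthogonal : ∀ i → IsOrthogonalArray t k n (L i)
    partitions : (v : Vector (Fin n) k) → ∃! _≡_ λ i → v OccursIn L i

{-# OPTIONS --safe #-}
-- Translating all rows of an orthogonal array by a fixed vector over ℤ_n gives
-- an orthogonal array again.  The large set consists of the translates by the
-- n ^ (k ∸ t) vectors that vanish on the first t columns: the first t entries
-- of v determine the row of the given array that can be translated to v, and
-- the remaining entries of v then determine the translation.
module Submission where

open import Defs
open import Algebra.Bundles using (AbelianGroup; Group)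
open import Algebra.Consequences.Propositional using (comm∧idˡ⇒id; comm∧invˡ⇒inv)
open import Algebra.Definitions using (Associative; Commutative; LeftIdentity; LeftInverse)
import Algebra.Properties.Group as GroupProperties
open import Data.Fin.Base using (Fin; zero; suc; toℕ; fromℕ<; combine; finToFun; funToFin)
open import Data.Fin.Properties
  using (toℕ<n; toℕ-injective; toℕ-fromℕ<; fromℕ<-cong; +↔⊎; finToFun-funToFin; funToFin-finToFin)
open import Data.Nat.Base using (ℕ; zero; suc; NonZero; _≤_; _+_; _∸_; _^_; _%_; >-nonZero⁻¹)
open import Data.Nat.DivMod using (_mod_; m%n<n; n%n≡0; %-distribˡ-+; m<n⇒m%n≡m)
open import Data.Nat.Properties
  using (+-assoc; +-comm; m+[n∸m]≡n; m∸n+n≡m; <⇒≤; m^n≢0)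
open import Data.Product using (∃; ∃!; _,_)
open import Data.Sum.Base using (_⊎_; inj₁; inj₂; [_,_]′)
open import Data.Sum.Properties using (inj₁-injective)
open import Data.Vec.Functional using (Vector; zipWith)
open import Function.Base using (_∘_; const)
open import Function.Bundles using (_↔_; Inverse)
open import Function.Definitions using (Injective)
open import Level using (0ℓ)
open import Relation.Binary.PropositionalEquality
  using (_≡_; _≗_; refl; sym; trans; cong; cong₂; subst; isEquivalence; module ≡-Reasoning)

-- Vectors here agree only pointwise, so `cong` cannot carry such an agreement over to their codes.
funToFin-cong : ∀ {m n} {f g : Fin m → Fin n} → f ≗ g → funToFin f ≡ funToFin g
funToFin-cong {zero}  f≗g = refl
funToFin-cong {suc m} f≗g = cong₂ combine (f≗g zero) (funToFin-cong (f≗g ∘ suc))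

module Modular (n : ℕ) .{{_ : NonZero n}} where

  open ≡-Reasoning

  infixl 6 _⊕_

  _⊕_ : Fin n → Fin n → Fin n
  x ⊕ y = (toℕ x + toℕ y) mod n

  -- The reduction matters only at `𝟘`, where the difference is `n` itself.
  ⊖_ : Fin n → Fin n
  ⊖ x = (n ∸ toℕ x) mod n

  𝟘 : Fin n
  𝟘 = 0 mod n

  toℕ-mod : ∀ m → toℕ (m mod n) ≡ m % n
  toℕ-mod m = toℕ-fromℕ< (m%n<n m n)

  toℕ-% : ∀ (x : Fin n) → toℕ x % n ≡ toℕ x
  toℕ-% x = m<n⇒m%n≡m (toℕ<n x)

  mod-cong-% : ∀ {l m} → l % n ≡ m % n → l mod n ≡ m mod n
  mod-cong-% {l} {m} eq = fromℕ<-cong _ _ eq (m%n<n l n) (m%n<n m n)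

  toℕ-mod-id : ∀ (x : Fin n) → toℕ x mod n ≡ x
  toℕ-mod-id x = toℕ-injective (trans (toℕ-mod (toℕ x)) (toℕ-% x))

  -- Reduction is additive. The group laws below then follow from those of ℕ once each element `x`
  -- is written as `toℕ x mod n`.
  mod-⊕ : ∀ l m → l mod n ⊕ m mod n ≡ (l + m) mod n
  mod-⊕ l m = mod-cong-% (begin
    (toℕ (l mod n) + toℕ (m mod n)) % n  ≡⟨ cong₂ (λ a b → (a + b) % n) (toℕ-mod l) (toℕ-mod m) ⟩
    (l % n + m % n) % n                  ≡⟨ %-distribˡ-+ l m n ⟨
    (l + m) % n                          ∎)

  ⊕-assoc : Associative _≡_ _⊕_
  ⊕-assoc x y z = begin
    x ⊕ y ⊕ z                            ≡⟨ cong (x ⊕ y ⊕_) (toℕ-mod-id z) ⟨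
    x ⊕ y ⊕ toℕ z mod n                  ≡⟨ mod-⊕ (toℕ x + toℕ y) (toℕ z) ⟩
    (toℕ x + toℕ y + toℕ z) mod n        ≡⟨ cong (_mod n) (+-assoc (toℕ x) (toℕ y) (toℕ z)) ⟩
    (toℕ x + (toℕ y + toℕ z)) mod n      ≡⟨ mod-⊕ (toℕ x) (toℕ y + toℕ z) ⟨
    toℕ x mod n ⊕ (y ⊕ z)                ≡⟨ cong (_⊕ (y ⊕ z)) (toℕ-mod-id x) ⟩
    x ⊕ (y ⊕ z)                          ∎

  ⊕-comm : Commutative _≡_ _⊕_
  ⊕-comm x y = cong (_mod n) (+-comm (toℕ x) (toℕ y))

  ⊕-identityˡ : LeftIdentity _≡_ 𝟘 _⊕_
  ⊕-identityˡ x = begin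
    𝟘 ⊕ x              ≡⟨ cong (𝟘 ⊕_) (toℕ-mod-id x) ⟨
    𝟘 ⊕ toℕ x mod n    ≡⟨ mod-⊕ 0 (toℕ x) ⟩
    toℕ x mod n        ≡⟨ toℕ-mod-id x ⟩
    x                  ∎

  ⊖-inverseˡ : LeftInverse _≡_ 𝟘 ⊖_ _⊕_
  ⊖-inverseˡ x = begin
    ⊖ x ⊕ x                    ≡⟨ cong (⊖ x ⊕_) (toℕ-mod-id x) ⟨
    ⊖ x ⊕ toℕ x mod n          ≡⟨ mod-⊕ (n ∸ toℕ x) (toℕ x) ⟩
    (n ∸ toℕ x + toℕ x) mod n  ≡⟨ cong (_mod n) (m∸n+n≡m (<⇒≤ (toℕ<n x))) ⟩
    -- Both sides have remainder 0; for `0 % n` this is an instance of `0 < n`.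
    n mod n                    ≡⟨ mod-cong-% (trans (n%n≡0 n) (sym (m<n⇒m%n≡m (>-nonZero⁻¹ n)))) ⟩
    𝟘                          ∎

  ⊕-abelianGroup : AbelianGroup 0ℓ 0ℓ
  ⊕-abelianGroup = record
    { _∙_ = _⊕_
    ; ε = 𝟘
    ; _⁻¹ = ⊖_
    ; isAbelianGroup = record
      { isGroup = record
        { isMonoid = record
          { isSemigroup = record
            { isMagma = record { isEquivalence = isEquivalence ; ∙-cong = cong₂ _⊕_ }
            ; assoc = ⊕-assoc
            }
          ; identity = comm∧idˡ⇒id ⊕-comm ⊕-identityˡ
          }
        ; inverse = comm∧invˡ⇒inv ⊕-comm ⊖-inverseˡ
        ; ⁻¹-cong = cong ⊖_
        }
      ; comm = ⊕-comm
      }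
    }

module Translates (n : ℕ) .{{_ : NonZero n}} where

  open Modular n
  open AbelianGroup ⊕-abelianGroup using (group; identityʳ)
  open Group group using (_//_; _\\_)
  open GroupProperties group
    using (\\-leftDividesˡ; \\-leftDividesʳ; //-rightDividesˡ; //-rightDividesʳ)

  translate : ∀ {m k} → Matrix (Fin n) m k → Vector (Fin n) k → Matrix (Fin n) m k
  translate M a r = zipWith _⊕_ (M r) a

  -- A row of the translate shows `x` in the columns `c` exactly when the same row of `M` shows `x`
  -- minus `a ∘ c` there.
  translate-orthogonal : ∀ {t k} M → IsOrthogonalArray t k n M →
                         ∀ a → IsOrthogonalArray t k n (translate M a)
  translate-orthogonal M oa a c c-inj x
    with r , Mr≗ , unique ← oa c c-inj (zipWith _//_ x (a ∘ c))
    = r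
    , (λ j → trans (cong (_⊕ a (c j)) (Mr≗ j)) (//-rightDividesˡ (a (c j)) (x j)))
    , λ {s} eq → unique λ j →
        trans (sym (//-rightDividesʳ (a (c j)) (M s (c j)))) (cong (_// a (c j)) (eq j))

  -- An arbitrary bijection splits the columns, which keeps the arithmetic of `k ∸ t` out of the
  -- argument; `m` stands for that difference.
  module LargeSet {t k m : ℕ} (columns : Fin k ↔ (Fin t ⊎ Fin m))
                  (M : Matrix (Fin n) (n ^ t) k) (oa : IsOrthogonalArray t k n M) where

    open Inverse columns using (to; from; strictlyInverseˡ; strictlyInverseʳ)

    pad : Vector (Fin n) m → Vector (Fin n) k
    pad y = [ const 𝟘 , y ]′ ∘ to

    -- `finToFun` decodes `i` into `m` entries, so each vector that vanishes on the initial columns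
    -- serves for exactly one index.
    family : Fin (n ^ m) → Matrix (Fin n) (n ^ t) k
    family i = translate M (pad (finToFun i))

    initial : Fin t → Fin k
    initial = from ∘ inj₁

    final : Fin m → Fin k
    final = from ∘ inj₂

    initial-injective : Injective _≡_ _≡_ initial
    initial-injective {i} {j} eq = inj₁-injective
      (trans (sym (strictlyInverseˡ (inj₁ i))) (trans (cong to eq) (strictlyInverseˡ (inj₁ j))))

    family-initial : ∀ i r j → family i r (initial j) ≡ M r (initial j)
    family-initial i r j rewrite strictlyInverseˡ (inj₁ j) = identityʳ (M r (initial j))

    family-final : ∀ i r j → family i r (final j) ≡ M r (final j) ⊕ finToFun i j
    family-final i r j rewrite strictlyInverseˡ (inj₂ j) = refl

    ≗-columns : {u v : Vector (Fin n) k} → u ∘ initial ≗ v ∘ initial → u ∘ final ≗ v ∘ final → u ≗ v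
    -- Matching the inverse law with `refl` turns `j` into `initial i` or `final i`.
    ≗-columns eq₁ eq₂ j with to j | strictlyInverseʳ j
    ... | inj₁ i | refl = eq₁ i
    ... | inj₂ i | refl = eq₂ i

    family-orthogonal : ∀ i → IsOrthogonalArray t k n (family i)
    family-orthogonal i = translate-orthogonal M oa (pad (finToFun i))

    family-partitions : (v : Vector (Fin n) k) → ∃! _≡_ λ i → v OccursIn family i
    family-partitions v with r , Mr≗ , unique ← oa initial initial-injective (v ∘ initial)
      = funToFin y , (r , ≗-columns on-initial on-final) , same-index
      where
      open ≡-Reasoning

      y : Vector (Fin n) m
      y j = M r (final j) \\ v (final j)

      on-initial : family (funToFin y) r ∘ initial ≗ v ∘ initial
      on-initial j = trans (family-initial (funToFin y) r j) (Mr≗ j)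

      on-final : family (funToFin y) r ∘ final ≗ v ∘ final
      on-final j = begin
        family (funToFin y) r (final j)                 ≡⟨ family-final (funToFin y) r j ⟩
        M r (final j) ⊕ finToFun (funToFin y) j         ≡⟨ cong (M r (final j) ⊕_) (finToFun-funToFin y j) ⟩
        M r (final j) ⊕ (M r (final j) \\ v (final j))  ≡⟨ \\-leftDividesˡ (M r (final j)) (v (final j)) ⟩
        v (final j)                                     ∎

      same-index : ∀ {i} → v OccursIn family i → funToFin y ≡ i
      -- Translation leaves the initial columns alone, so row `s` of `M` agrees with `v` there and
      -- must be row `r`. Cancelling that row in the final columns recovers the entries of `i`.
      same-index {i} (s , eq) with unique {s} (λ j → trans (sym (family-initial i s j)) (eq (initial j)))
      ... | refl = trans (funToFin-cong y≗) (funToFin-finToFin {m} i)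
        where
        y≗ : y ≗ finToFun i
        y≗ j = begin
          M r (final j) \\ v (final j)                     ≡⟨ cong (M r (final j) \\_) (eq (final j)) ⟨
          M r (final j) \\ family i r (final j)            ≡⟨ cong (M r (final j) \\_) (family-final i r j) ⟩
          M r (final j) \\ (M r (final j) ⊕ finToFun i j)  ≡⟨ \\-leftDividesʳ (M r (final j)) (finToFun i j) ⟩
          finToFun i j                                     ∎

    -- Distinctness needs a row to compare: arrays without rows would all be equal.
    someRow : Fin (n ^ t)
    someRow = fromℕ< (>-nonZero⁻¹ (n ^ t) {{m^n≢0 n t}})

    -- Equal members share a row, which occurs in only one member.
    family-distinct : Injective _≡_ _≋_ family
    family-distinct {i} eq with _ , _ , unique ← family-partitions (family i someRow)
      = trans (sym (unique (someRow , λ _ → refl))) (unique (someRow , λ l → sym (eq someRow l)))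

-- This is where `t ≤ k` enters: it makes `t + (k ∸ t)` equal to `k`.
splitColumns : ∀ {t k} → t ≤ k → Fin k ↔ (Fin t ⊎ Fin (k ∸ t))
splitColumns {t} {k} t≤k = subst (λ l → Fin l ↔ (Fin t ⊎ Fin (k ∸ t))) (m+[n∸m]≡n t≤k) +↔⊎

theorem3 : (t k n : ℕ) .{{_ : NonZero t}} .{{_ : NonZero k}} .{{_ : NonZero n}} →
    t ≤ k → ∃ (IsOrthogonalArray t k n) → ∃ (IsLargeSet t k n)
theorem3 t k n t≤k (M , oa) = family , record
  { distinct   = family-distinct
  ; orthogonal = family-orthogonal
  ; partitions = family-partitions
  }
  where
  open Translates n
  open LargeSet (splitColumns t≤k) M oa
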